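{- Let $H_1\Leftarrow_{r_1,g_1}G\Rightarrow_{r_2,g_2}H_2$ be direct derivations of TLRGs in the R-GT sense which are parallelly independent, i.e. $g_1(L_1)\cap g_2(L_2)\subseteq g_1(K_1)\cap g_2(K_2)$. Then there exist a TLRG $G'$ and direct derivations $H_1\Rightarrow_{r_2}G'\Leftarrow_{r_1}H_2$ such that $G\Rightarrow_{r_1}H_1\Rightarrow_{r_2}G'$ and $G\Rightarrow_{r_2}H_2\Rightarrow_{r_1}G'$ are sequentially independent.
   Context: Fix a label alphabet $\mathcal L=(\mathcal L_V,\mathcal L_E)$. Graphs are $G=(V,E,s,t,l,m,p)$ with $V,E$ finite, $s,t:E\to V$ total, $l:V\rightharpoonup\mathcal L_V$ partial, $m:E\to\mathcal L_E$ total, $p:V\rightharpoonup\{0,1\}$ partial (rootedness); TLRG = $l,p$ total; morphisms preserve sources, targets, edge labels, and node labels and rootedness wherever defined. A rule $r_i=\langle L_i\leftarrow K_i\rightarrow R_i\rangle$ has TLRGs $L_i,R_i$ and a common subgraph $K_i$ (sets included, $s,t,m$ restricted, $l_{K_i}\subseteq l_{L_i}$, $p_{K_i}\subseteq p_{L_i}$, likewise for $R_i$). A direct derivation $G\Rightarrow_{r,g}H$ applies $r$ to TLRG $G$ via an injective match $g:L\to G$ satisfying the dangling condition (no edge outside $g(L)$ incident to a node of $g(V_L\setminus V_K)$): delete images of items of $L$ not in $K$ and undefine label/rootedness of $g_V(v)$ where undefined for $v\in V_K$; add disjointly items of $R$ not in $K$ and set label/rootedness of $g_V(v)$ to $l_R(v)/p_R(v)$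 where undefined in $K$ (result up to isomorphism). The comatch $h:R\to H$ maps $K$ as $g$ does and $R\setminus K$ onto the added items. Derivations $G_1\Rightarrow_{r_1,g_1}H\Rightarrow_{r_2,g_2}G_2$ (with comatch $h_1$ of the first) are sequentially independent if $h_1(R_1)\cap g_2(L_2)\subseteq h_1(K_1)\cap g_2(K_2)$. -}

module Defs where

open import Data.Bool using (Bool; if_then_else_)
open import Data.Empty using (⊥-elim)
open import Data.Fin using (Fin; zero; suc)
open import Data.Fin.Properties using (any?; +↔⊎; inj⇒≟)
open import Data.Maybe using (Maybe; just; nothing; is-just; Is-just)
open import Data.Nat using (ℕ; zero; suc)
open import Data.Product using (Σ; ∃; _×_; _,_; proj₁; proj₂)
open import Data.Sum using (_⊎_; inj₁; inj₂)
open import Data.Sum.Function.Propositional using (_⊎-↔_)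
open import Function using (_∘_; id; Injective; _↔_; Inverse; mk↔ₛ′)
open import Function.Properties.Inverse using (↔-trans; ↔-sym; Inverse⇒Injection)
open import Level using (0ℓ)
open import Relation.Binary using (REL; DecidableEquality)
  renaming (_⇒_ to _⊆₂_)
open import Relation.Binary.Construct.Intersection
  using () renaming (_∩_ to _∩₂_)
open import Relation.Binary.PropositionalEquality
open import Relation.Nullary using (¬_; Dec; yes; no; ¬?; _×-dec_)
open import Relation.Nullary.Decidable using (map′)
open import Relation.Unary using (Pred; Decidable; _∩_; _⊆_)

------------------------------------------------------------------------
-- Finite sets

Finite : Set → Set
Finite A = ∃ λ n → A ↔ Fin n

private
  variable
    A B : Set

finite⇒≟ : Finite A → DecidableEquality A
finite⇒≟ (_ , A↔n) = inj⇒≟ (Inverse⇒Injection A↔n)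

finite-any? : Finite A → {P : Pred A 0ℓ} → Decidable P → Dec (∃ P)
finite-any? (_ , A↔n) {P} P? = map′
  (λ (i , p) → from i , p)
  (λ (a , p) → to a , subst P (sym (strictlyInverseʳ a)) p)
  (any? (P? ∘ from))
  where open Inverse A↔n

finite-⊎ : Finite A → Finite B → Finite (A ⊎ B)
finite-⊎ (_ , f) (_ , g) = _ , ↔-trans (f ⊎-↔ g) (↔-sym +↔⊎)

-- Proofs of a negation are definitionally equal, so ∃ λ a → ¬ P a is the
-- subset of A on which P fails.
≡-¬ : {P : Pred A 0ℓ} {x y : ∃ λ a → ¬ P a} → proj₁ x ≡ proj₁ y → x ≡ y
≡-¬ refl = refl

fin-complement : ∀ n {P : Pred (Fin n) 0ℓ} → Decidable P →
                 Finite (∃ λ i → ¬ P i)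
fin-complement zero P? =
  0 , mk↔ₛ′ (λ ()) (λ ()) (λ ()) (λ ())
fin-complement (suc n) {P} P? =
  let _ , f = finite-⊎ (head (P? zero)) (fin-complement n (P? ∘ suc))
  in  _ , ↔-trans split f
  where
  head : Dec (P zero) → Finite (¬ P zero)
  head (yes p) = 0 , mk↔ₛ′ (λ ¬p → ⊥-elim (¬p p)) (λ ()) (λ ())
                           (λ ¬p → ⊥-elim (¬p p))
  head (no ¬p) = 1 , mk↔ₛ′ (λ _ → zero) (λ _ → ¬p)
                           (λ { zero → refl }) (λ _ → refl)

  split : (∃ λ i → ¬ P i) ↔ (¬ P zero ⊎ ∃ λ i → ¬ P (suc i))
  split = mk↔ₛ′
    (λ { (zero , ¬p) → inj₁ ¬p ; (suc i , ¬p) → inj₂ (i , ¬p) })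
    (λ { (inj₁ ¬p) → zero , ¬p ; (inj₂ (i , ¬p)) → suc i , ¬p })
    (λ { (inj₁ _) → refl ; (inj₂ _) → refl })
    (λ { (zero , _) → refl ; (suc _ , _) → refl })

finite-complement : Finite A → {P : Pred A 0ℓ} → Decidable P →
                    Finite (∃ λ a → ¬ P a)
finite-complement {A} (n , A↔n) {P} P? =
  let m , f = fin-complement n (P? ∘ from) in m , ↔-trans reindex f
  where
  open Inverse A↔n

  reindex : (∃ λ a → ¬ P a) ↔ (∃ λ i → ¬ P (from i))
  reindex = mk↔ₛ′
    (λ (a , ¬p) → to a , λ p → ¬p (subst P (strictlyInverseʳ a) p))
    (λ (i , ¬p) → from i , ¬p)
    (λ (i , _) → ≡-¬ (strictlyInverseˡ i))
    (λ (a , _) → ≡-¬ (strictlyInverseʳ a))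

Image : (A → B) → Pred B 0ℓ
Image f b = ∃ λ a → f a ≡ b

image? : Finite A → Finite B → (f : A → B) → Decidable (Image f)
image? finA finB f b = finite-any? finA (λ a → finite⇒≟ finB (f a) b)

-- f (A ∖ i(C)), for i : C → A and f : A → B.
ImageOutside : {C : Set} → (C → A) → (A → B) → Pred B 0ℓ
ImageOutside i f b = ∃ λ a → ¬ Image i a × f a ≡ b

imageOutside? : {C : Set} → Finite C → Finite A → Finite B →
                (i : C → A) (f : A → B) → Decidable (ImageOutside i f)
imageOutside? finC finA finB i f b = finite-any? finA λ a →
  ¬? (image? finC finA i a) ×-dec finite⇒≟ finB (f a) b

------------------------------------------------------------------------
-- Graphs

record LabelAlphabet : Set₁ where
  field
    NodeLabel EdgeLabel : Set

open LabelAlphabet public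

private
  variable
    ℒ : LabelAlphabet

-- Partial functions are Maybe-valued; rootedness 0/1 is false/true.
record Graph (ℒ : LabelAlphabet) : Set₁ where
  field
    V E      : Set
    V-finite : Finite V
    E-finite : Finite E
    s t      : E → V
    l        : V → Maybe (NodeLabel ℒ)
    m        : E → EdgeLabel ℒ
    p        : V → Maybe Bool

record TLRG (ℒ : LabelAlphabet) : Set₁ where
  field
    graph : Graph ℒ
  open Graph graph public
  field
    l-total : ∀ v → Is-just (l v)
    p-total : ∀ v → Is-just (p v)

open TLRG using (graph)

record Morphism (G H : Graph ℒ) : Set where
  private
    module G = Graph G
    module H = Graph H
  field
    onV         : G.V → H.V
    onE         : G.E → H.E
    preserves-s : ∀ e → H.s (onE e) ≡ onV (G.s e)
    preserves-t : ∀ e → H.t (onE e) ≡ onV (G.t e)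
    preserves-m : ∀ e → H.m (onE e) ≡ G.m e
    preserves-l : ∀ {v a} → G.l v ≡ just a → H.l (onV v) ≡ just a
    preserves-p : ∀ {v b} → G.p v ≡ just b → H.p (onV v) ≡ just b

open Morphism public

infixr 9 _∘ₘ_

_∘ₘ_ : {F G H : Graph ℒ} → Morphism G H → Morphism F G → Morphism F H
g ∘ₘ f = record
  { onV         = onV g ∘ onV f
  ; onE         = onE g ∘ onE f
  ; preserves-s = λ e → trans (preserves-s g _) (cong (onV g) (preserves-s f e))
  ; preserves-t = λ e → trans (preserves-t g _) (cong (onV g) (preserves-t f e))
  ; preserves-m = λ e → trans (preserves-m g _) (preserves-m f e)
  ; preserves-l = preserves-l g ∘ preserves-l f
  ; preserves-p = preserves-p g ∘ preserves-p f
  }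

InjectiveMorphism : {G H : Graph ℒ} → Morphism G H → Set
InjectiveMorphism f = Injective _≡_ _≡_ (onV f) × Injective _≡_ _≡_ (onE f)

infix 4 _≅_

record _≅_ (G H : Graph ℒ) : Set where
  field
    to       : Morphism G H
    from     : Morphism H G
    to-fromV : ∀ v → onV to (onV from v) ≡ v
    from-toV : ∀ v → onV from (onV to v) ≡ v
    to-fromE : ∀ e → onE to (onE from e) ≡ e
    from-toE : ∀ e → onE from (onE to e) ≡ e

------------------------------------------------------------------------
-- Rules and matches

-- The inclusions of the common subgraph K are injective morphisms: these
-- restrict s, t and m, and the labels and rootedness values of K are among
-- those of L and R.
record Rule (ℒ : LabelAlphabet) : Set₁ where
  field
    L R           : TLRG ℒ
    K             : Graph ℒ
    inL           : Morphism K (graph L)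
    inR           : Morphism K (graph R)
    inL-injective : InjectiveMorphism inL
    inR-injective : InjectiveMorphism inR

  module L = TLRG L
  module R = TLRG R
  module K = Graph K

record Match (r : Rule ℒ) (G : TLRG ℒ) : Set where
  open Rule r
  private
    module G = TLRG G
  field
    g           : Morphism L.graph G.graph
    g-injective : InjectiveMorphism g

  DeletedV : Pred G.V 0ℓ
  DeletedV = ImageOutside (onV inL) (onV g)

  DeletedE : Pred G.E 0ℓ
  DeletedE = ImageOutside (onE inL) (onE g)

  field
    dangling : ∀ e → ¬ Image (onE g) e →
               ¬ DeletedV (G.s e) × ¬ DeletedV (G.t e)

------------------------------------------------------------------------
-- Rule application

module Apply {r : Rule ℒ} {G : TLRG ℒ} (match : Match r G) where
  open Rule r
  open Match match
  private
    module G = TLRG G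

  KeptV KeptE AddedV AddedE : Set
  KeptV  = ∃ λ v → ¬ DeletedV v
  KeptE  = ∃ λ e → ¬ DeletedE e
  AddedV = ∃ λ w → ¬ Image (onV inR) w
  AddedE = ∃ λ e → ¬ Image (onE inR) e

  gK : Morphism K G.graph
  gK = g ∘ₘ inL

  endpoint-kept :
    (endL : L.E → L.V) (endK : K.E → K.V) (endG : G.E → G.V) →
    (∀ e → endL (onE inL e) ≡ onV inL (endK e)) →
    (∀ e → endG (onE g e) ≡ onV g (endL e)) →
    (∀ e → ¬ Image (onE g) e → ¬ DeletedV (endG e)) →
    ∀ {e} → ¬ DeletedE e → ¬ DeletedV (endG e)
  endpoint-kept endL endK endG inL-end g-end outside {e} kept
                del@(v , v∉K , gv≡end) =
    outside e
      (λ (e′ , ge′≡e) → kept (e′ , (λ (k , k≡e′) →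
        v∉K (endK k , proj₁ g-injective (begin
          onV g (onV inL (endK k)) ≡⟨ cong (onV g) (inL-end k) ⟨
          onV g (endL (onE inL k)) ≡⟨ cong (onV g ∘ endL) k≡e′ ⟩
          onV g (endL e′)          ≡⟨ g-end e′ ⟨
          endG (onE g e′)          ≡⟨ cong endG ge′≡e ⟩
          endG e                   ≡⟨ gv≡end ⟨
          onV g v                  ∎))) , ge′≡e))
      del
    where open ≡-Reasoning

  onK? : Decidable (Image (onV gK))
  onK? = image? K.V-finite G.V-finite (onV gK)

  cut : (K.V → Maybe A) → (G.V → Maybe A) → KeptV → Maybe A
  cut attrK attrG (v , _) with onK? v
  ... | yes (k , _) = if is-just (attrK k) then attrG v else nothing
  ... | no  _       = attrG v

  remainder : Graph ℒ
  remainder = record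
    { V        = KeptV
    ; E        = KeptE
    ; V-finite = finite-complement G.V-finite
        (imageOutside? K.V-finite L.V-finite G.V-finite (onV inL) (onV g))
    ; E-finite = finite-complement G.E-finite
        (imageOutside? K.E-finite L.E-finite G.E-finite (onE inL) (onE g))
    ; s        = λ (e , kept) → G.s e ,
        endpoint-kept L.s K.s G.s (preserves-s inL) (preserves-s g)
          (λ e → proj₁ ∘ dangling e) kept
    ; t        = λ (e , kept) → G.t e ,
        endpoint-kept L.t K.t G.t (preserves-t inL) (preserves-t g)
          (λ e → proj₂ ∘ dangling e) kept
    ; l        = cut K.l G.l
    ; m        = λ (e , _) → G.m e
    ; p        = cut K.p G.p
    }

  private
    module D = Graph remainder

  dV : K.V → KeptV
  dV k = onV gK k , λ (v , v∉K , gv≡gk) → v∉K (k , sym (proj₁ g-injective gv≡gk))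

  dE : K.E → KeptE
  dE k = onE gK k , λ (e , e∉K , ge≡gk) → e∉K (k , sym (proj₂ g-injective ge≡gk))

  hV : R.V → KeptV ⊎ AddedV
  hV w with image? K.V-finite R.V-finite (onV inR) w
  ... | yes (k , _) = inj₁ (dV k)
  ... | no  w∉K     = inj₂ (w , w∉K)

  hE : R.E → KeptE ⊎ AddedE
  hE e with image? K.E-finite R.E-finite (onE inR) e
  ... | yes (k , _) = inj₁ (dE k)
  ... | no  e∉K     = inj₂ (e , e∉K)

  paste : (K.V → Maybe A) → (R.V → Maybe A) → (KeptV → Maybe A) →
          KeptV ⊎ AddedV → Maybe A
  paste attrK attrR attrD (inj₂ (w , _)) = attrR w
  paste attrK attrR attrD (inj₁ x) with onK? (proj₁ x)
  ... | yes (k , _) = if is-just (attrK k) then attrD x else attrR (onV inR k)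
  ... | no  _       = attrD x

  endpoint : (R.E → R.V) → (KeptE → KeptV) → KeptE ⊎ AddedE → KeptV ⊎ AddedV
  endpoint endR endD (inj₁ e)       = inj₁ (endD e)
  endpoint endR endD (inj₂ (e , _)) = hV (endR e)

  result : Graph ℒ
  result = record
    { V        = KeptV ⊎ AddedV
    ; E        = KeptE ⊎ AddedE
    ; V-finite = finite-⊎ D.V-finite
        (finite-complement R.V-finite (image? K.V-finite R.V-finite (onV inR)))
    ; E-finite = finite-⊎ D.E-finite
        (finite-complement R.E-finite (image? K.E-finite R.E-finite (onE inR)))
    ; s        = endpoint R.s D.s
    ; t        = endpoint R.t D.t
    ; l        = paste K.l R.l D.l
    ; m        = λ { (inj₁ e) → D.m e ; (inj₂ (e , _)) → R.m e }
    ; p        = paste K.p R.p D.p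
    }

  private
    module H = Graph result

  hV-inR : ∀ k → hV (onV inR k) ≡ inj₁ (dV k)
  hV-inR k with image? K.V-finite R.V-finite (onV inR) (onV inR k)
  ... | yes (k′ , eq) = cong (inj₁ ∘ dV) (proj₁ inR-injective eq)
  ... | no  k∉K       = ⊥-elim (k∉K (k , refl))

  h-end : (endR : R.E → R.V) (endK : K.E → K.V) (endD : KeptE → KeptV) →
          (∀ k → endR (onE inR k) ≡ onV inR (endK k)) →
          (∀ k → endD (dE k) ≡ dV (endK k)) →
          ∀ e → endpoint endR endD (hE e) ≡ hV (endR e)
  h-end endR endK endD inR-end d-end e
    with image? K.E-finite R.E-finite (onE inR) e
  ... | no  _          = refl
  ... | yes (k , refl) = trans (cong inj₁ (d-end k))
          (sym (trans (cong hV (inR-end k)) (hV-inR (endK k))))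

  h-m : ∀ e → H.m (hE e) ≡ R.m e
  h-m e with image? K.E-finite R.E-finite (onE inR) e
  ... | no  _          = refl
  ... | yes (k , refl) = trans (preserves-m gK k) (sym (preserves-m inR k))

  cut-defined : (attrK : K.V → Maybe A) (attrG : G.V → Maybe A) →
                ∀ {k a} → attrK k ≡ just a →
                cut attrK attrG (dV k) ≡ attrG (onV gK k)
  cut-defined attrK attrG {k} k↦ with onK? (onV gK k)
  ... | no  _ = refl
  ... | yes (_ , eq)
        with refl ← proj₁ inL-injective (proj₁ g-injective eq)
        rewrite k↦ = refl

  paste-dV : (attrK : K.V → Maybe A) (attrR : R.V → Maybe A)
             (attrD : KeptV → Maybe A) → ∀ k →
             paste attrK attrR attrD (inj₁ (dV k)) ≡
             (if is-just (attrK k) then attrD (dV k) else attrR (onV inR k))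
  paste-dV attrK attrR attrD k with onK? (onV gK k)
  ... | no  k∉K = ⊥-elim (k∉K (k , refl))
  ... | yes (_ , eq)
        with refl ← proj₁ inL-injective (proj₁ g-injective eq) = refl

  h-attr : (attrK : K.V → Maybe A) (attrG : G.V → Maybe A)
           (attrR : R.V → Maybe A) →
           (∀ {k a} → attrK k ≡ just a → attrG (onV gK k) ≡ just a) →
           (∀ {k a} → attrK k ≡ just a → attrR (onV inR k) ≡ just a) →
           ∀ {w a} → attrR w ≡ just a →
           paste attrK attrR (cut attrK attrG) (hV w) ≡ just a
  h-attr attrK attrG attrR K⊆G K⊆R {w} eq
    with image? K.V-finite R.V-finite (onV inR) w
  ... | no  _ = eq
  ... | yes (k , refl)
        with attrK k in k↦ | paste-dV attrK attrR (cut attrK attrG) k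
  ...     | nothing | pasted = trans pasted eq
  ...     | just _  | pasted = begin
    paste attrK attrR (cut attrK attrG) (inj₁ (dV k)) ≡⟨ pasted ⟩
    cut attrK attrG (dV k)        ≡⟨ cut-defined attrK attrG k↦ ⟩
    attrG (onV gK k)              ≡⟨ K⊆G k↦ ⟩
    just _                        ≡⟨ K⊆R k↦ ⟨
    attrR (onV inR k)             ≡⟨ eq ⟩
    just _                        ∎
    where open ≡-Reasoning

  resultComatch : Morphism R.graph result
  resultComatch = record
    { onV         = hV
    ; onE         = hE
    ; preserves-s = h-end R.s K.s D.s (preserves-s inR) (≡-¬ ∘ preserves-s gK)
    ; preserves-t = h-end R.t K.t D.t (preserves-t inR) (≡-¬ ∘ preserves-t gK)
    ; preserves-m = h-m
    ; preserves-l = h-attr K.l G.l R.l (preserves-l gK) (preserves-l inR)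
    ; preserves-p = h-attr K.p G.p R.p (preserves-p gK) (preserves-p inR)
    }

infix 4 _⇒[_]_

record _⇒[_]_ (G : TLRG ℒ) (r : Rule ℒ) (H : TLRG ℒ) : Set where
  open Rule r
  field
    match : Match r G
    iso   : Apply.result match ≅ graph H

  open Match match public using (g)

  comatch : Morphism R.graph (graph H)
  comatch = _≅_.to iso ∘ₘ Apply.resultComatch match

------------------------------------------------------------------------
-- Independence

-- A graph inside an ambient graph G.  Its sources, targets and edge labels
-- are those of G; its partial label and rootedness functions are given by
-- their graphs, which may be smaller than those of G.
record Part (G : Graph ℒ) : Set₁ where
  private
    module G = Graph G
  field
    nodes  : Pred G.V 0ℓ
    edges  : Pred G.E 0ℓ
    labels : REL G.V (NodeLabel ℒ) 0ℓ
    roots  : REL G.V Bool 0ℓ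

open Part public

image : {F G : Graph ℒ} → Morphism F G → Part G
image {F = F} f = record
  { nodes  = Image (onV f)
  ; edges  = Image (onE f)
  ; labels = λ v a → ∃ λ x → onV f x ≡ v × Graph.l F x ≡ just a
  ; roots  = λ v b → ∃ λ x → onV f x ≡ v × Graph.p F x ≡ just b
  }

infixr 7 _⊓_

_⊓_ : {G : Graph ℒ} → Part G → Part G → Part G
P ⊓ Q = record
  { nodes  = nodes P ∩ nodes Q
  ; edges  = edges P ∩ edges Q
  ; labels = labels P ∩₂ labels Q
  ; roots  = roots P ∩₂ roots Q
  }

infix 4 _⊑_

-- Inclusion of graphs, in the same sense as for K in L: on shared nodes the
-- partial functions must be included too.  Inclusion of the item sets alone
-- would admit two derivations relabelling one node in conflicting ways.
_⊑_ : {G : Graph ℒ} → Part G → Part G → Set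
P ⊑ Q = nodes P ⊆ nodes Q × edges P ⊆ edges Q
      × labels P ⊆₂ labels Q × roots P ⊆₂ roots Q

ParallelIndependent : {r₁ r₂ : Rule ℒ} {G H₁ H₂ : TLRG ℒ} →
                      G ⇒[ r₁ ] H₁ → G ⇒[ r₂ ] H₂ → Set
ParallelIndependent {r₁ = r₁} {r₂ = r₂} δ₁ δ₂ =
  image g₁ ⊓ image g₂ ⊑ image (g₁ ∘ₘ inL r₁) ⊓ image (g₂ ∘ₘ inL r₂)
  where
  open Rule using (inL)
  g₁ = _⇒[_]_.g δ₁
  g₂ = _⇒[_]_.g δ₂

SequentiallyIndependent : {r₁ r₂ : Rule ℒ} {G₁ H G₂ : TLRG ℒ} →
                          G₁ ⇒[ r₁ ] H → H ⇒[ r₂ ] G₂ → Set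
SequentiallyIndependent {r₁ = r₁} {r₂ = r₂} δ₁ δ₂ =
  image h₁ ⊓ image g₂ ⊑ image (h₁ ∘ₘ inR r₁) ⊓ image (g₂ ∘ₘ inL r₂)
  where
  open Rule using (inL; inR)
  h₁ = _⇒[_]_.comatch δ₁
  g₂ = _⇒[_]_.g δ₂

{-# OPTIONS --safe #-}
module Submission where

-- Independence forces every item of G that both rules touch to lie in both
-- interfaces, with its label and rootedness already defined there.  Hence the
-- first derivation neither deletes nor relabels an item matched by the second
-- rule, so g₂ is still a match in H₁, and symmetrically for g₁ in H₂.  Either
-- order of application then leaves the items of G kept by both rules together
-- with those added by either; exchanging the order is an isomorphism, and on
-- each kept node at most one of the rules redefines the label.

open import Defs
open import Data.Bool using (Bool; if_then_else_)
open import Data.Empty using (⊥-elim)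
open import Data.Maybe using (Maybe; just; nothing; is-just; Is-just)
open import Data.Maybe.Relation.Unary.Any using (just)
open import Data.Product using (Σ-syntax; ∃; _×_; _,_; proj₁; proj₂; swap)
open import Data.Sum using (_⊎_; inj₁; inj₂)
open import Data.Sum.Properties using (inj₁-injective)
open import Data.Unit using (tt)
open import Function using (_∘_; id; Injective)
open import Level using (0ℓ)
open import Relation.Binary using (REL)
open import Relation.Binary.PropositionalEquality
open import Relation.Nullary using (¬_; yes; no)
open import Relation.Unary using (Decidable; _∩_; _⊆_)

private
  variable
    A B C D G H₁ H₂ : Set
    ℒ : LabelAlphabet

-- Rule application on bare sets of items

Kept : (C → A) → (A → D) → Set
Kept i g = ∃ λ x → ¬ ImageOutside i g x

Added : (C → B) → Set
Added j = ∃ λ w → ¬ Image j w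

Result : (C → A) → (C → B) → (A → D) → Set
Result i j g = Kept i g ⊎ Added j

inj₁-≡ : {i : C → A} {j : C → B} {g : A → D} {x y : Kept i g} →
         proj₁ x ≡ proj₁ y → _≡_ {A = Result i j g} (inj₁ x) (inj₁ y)
inj₁-≡ = cong inj₁ ∘ ≡-¬

image-kept : {i : C → A} {g : A → D} → Injective _≡_ _≡_ g →
             ∀ k → ¬ ImageOutside i g (g (i k))
image-kept g-injective k (v , v∉K , eq) = v∉K (k , sym (g-injective eq))

-- A comatch is determined by its values on and off K. Recording just these keeps the case analysis
-- inside `hV` and `hE` out of the later arguments and treats nodes and edges alike.
record IsComatch (i : C → A) (j : C → B) (g : A → D)
                 (h : B → Result i j g) : Set where
  field
    g-injective : Injective _≡_ _≡_ g
    j?          : Decidable (Image j)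
    on-K        : ∀ k → h (j k) ≡ inj₁ (g (i k) , image-kept g-injective k)
    off-K       : ∀ {w} (w∉K : ¬ Image j w) → h w ≡ inj₂ (w , w∉K)

-- What a direct derivation from G to H does to the nodes, or to the edges:
-- h is the comatch into the constructed result, which to identifies with H.
record Step (G H : Set) : Set₁ where
  field
    {K L R}   : Set
    i         : K → L
    j         : K → R
    g         : L → G
    h         : R → Result i j g
    isComatch : IsComatch i j g h
    to        : Result i j g → H
    from      : H → Result i j g
    to-from   : ∀ x → to (from x) ≡ x
    from-to   : ∀ y → from (to y) ≡ y

  open IsComatch isComatch public

  to-injective : Injective _≡_ _≡_ to
  to-injective {x} {y} eq =
    trans (sym (from-to x)) (trans (cong from eq) (from-to y))

-- Only the clause on item sets; labels and rootedness enter with `shared-attr`.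
Independent : Step G H₁ → Step G H₂ → Set
Independent σ₁ σ₂ = Image σ₁.g ∩ Image σ₂.g ⊆
                    Image (σ₁.g ∘ σ₁.i) ∩ Image (σ₂.g ∘ σ₂.i)
  where
  module σ₁ = Step σ₁
  module σ₂ = Step σ₂

Independent-sym : {σ₁ : Step G H₁} {σ₂ : Step G H₂} →
                  Independent σ₁ σ₂ → Independent σ₂ σ₁
Independent-sym ind p = swap (ind (swap p))

-- Transporting a match across an independent step

module Residual (σ₁ : Step G H₁) (σ₂ : Step G H₂)
                (ind : Independent σ₁ σ₂) where
  private
    module σ₁ = Step σ₁
    module σ₂ = Step σ₂

  -- An item matched by the second rule and deleted by the first would lie in g₁(L₁), hence by
  -- independence in g₁(K₁), which injectivity of g₁ forbids.
  survives : ∀ v → ¬ ImageOutside σ₁.i σ₁.g (σ₂.g v)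
  survives v (x , x∉K , eq) =
    let (k , gk≡) , _ = ind ((x , eq) , (v , refl))
    in  x∉K (k , σ₁.g-injective (trans gk≡ (sym eq)))

  residual : σ₂.L → H₁
  residual v = σ₁.to (inj₁ (σ₂.g v , survives v))

  residual-kept : ∀ {v x} {n : ¬ ImageOutside σ₁.i σ₁.g x} →
                  residual v ≡ σ₁.to (inj₁ (x , n)) → σ₂.g v ≡ x
  residual-kept eq = cong proj₁ (inj₁-injective (σ₁.to-injective eq))

  residual-kept⁻ : ∀ {v x} {n : ¬ ImageOutside σ₁.i σ₁.g x} →
                   σ₂.g v ≡ x → residual v ≡ σ₁.to (inj₁ (x , n))
  residual-kept⁻ refl = refl

  residual-added : ∀ {v w} → residual v ≢ σ₁.to (inj₂ w)
  residual-added eq with () ← σ₁.to-injective eq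

  -- Survivors of the first step embed injectively in `H₁`, so the second rule deletes the same ones
  -- there as in `G`.
  kept-before : ∀ {x} (n : ¬ ImageOutside σ₁.i σ₁.g x) →
                ¬ ImageOutside σ₂.i residual (σ₁.to (inj₁ (x , n))) →
                ¬ ImageOutside σ₂.i σ₂.g x
  kept-before n kept (v , v∉K , eq) = kept (v , v∉K , residual-kept⁻ {n = n} eq)

  kept-after : ∀ {x} (n : ¬ ImageOutside σ₁.i σ₁.g x) →
               ¬ ImageOutside σ₂.i σ₂.g x →
               ¬ ImageOutside σ₂.i residual (σ₁.to (inj₁ (x , n)))
  kept-after n kept (v , v∉K , eq) = kept (v , v∉K , residual-kept {n = n} eq)

  added-kept : ∀ {w} → ¬ ImageOutside σ₂.i residual (σ₁.to (inj₂ w))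
  added-kept (_ , _ , eq) = residual-added eq

  residual-injective : Injective _≡_ _≡_ residual
  residual-injective = σ₂.g-injective ∘ residual-kept

  -- `residual` reaches no item added by the first rule, so an overlap comes from K₁. It is then an
  -- item of `G` matched by both rules, and independence puts it in K₂ as well.
  comatch-overlap : ∀ {w v} → σ₁.to (σ₁.h w) ≡ residual v →
    ∃ λ k₁ → σ₁.j k₁ ≡ w × σ₁.g (σ₁.i k₁) ≡ σ₂.g v × Image σ₂.i v
  comatch-overlap {w} {v} eq with σ₁.j? w
  ... | no w∉K = ⊥-elim
          (residual-added (sym (trans (cong σ₁.to (sym (σ₁.off-K w∉K))) eq)))
  ... | yes (k₁ , refl) =
    let gk≡ = sym (residual-kept (sym (trans (cong σ₁.to (sym (σ₁.on-K k₁))) eq)))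
        _ , (k₂ , eq₂) = ind ((_ , gk≡) , (v , refl))
    in  k₁ , refl , gk≡ , (k₂ , σ₂.g-injective eq₂)

-- Exchanging the order of two independent steps

module Exchange (σ₁ : Step G H₁) (σ₂ : Step G H₂)
                (ind : Independent σ₁ σ₂) where
  private
    module σ₁ = Step σ₁
    module σ₂ = Step σ₂
    module ρ₁ = Residual σ₁ σ₂ ind
    module ρ₂ = Residual σ₂ σ₁ (Independent-sym {σ₁ = σ₁} {σ₂ = σ₂} ind)

  From To : Set
  From = Result σ₂.i σ₂.j ρ₁.residual
  To   = Result σ₁.i σ₁.j ρ₂.residual

  -- Splitting on the constructed result rather than on `H₁` exposes whether an item is old or
  -- added, which the abstract `H₁` hides.
  exchangeKept : (y : Result σ₁.i σ₁.j σ₁.g) →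
                 ¬ ImageOutside σ₂.i ρ₁.residual (σ₁.to y) → To
  exchangeKept (inj₁ (x , kept₁)) kept =
    inj₁ (σ₂.to (inj₁ (x , kept₂)) , ρ₂.kept-after kept₂ kept₁)
    where kept₂ = ρ₁.kept-before kept₁ kept
  exchangeKept (inj₂ w) _ = inj₂ w

  exchange : From → To
  exchange (inj₁ (x , n)) = exchangeKept (σ₁.from x)
    (subst (¬_ ∘ ImageOutside σ₂.i ρ₁.residual) (sym (σ₁.to-from x)) n)
  exchange (inj₂ w) = inj₁ (σ₂.to (inj₂ w) , ρ₂.added-kept)

  exchange-to : ∀ y n → exchange (inj₁ (σ₁.to y , n)) ≡ exchangeKept y n
  exchange-to y n = lemma (σ₁.from-to y)
    where
    lemma : ∀ {y′ n′} → y′ ≡ y → exchangeKept y′ n′ ≡ exchangeKept y n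
    -- Once the items agree, the two survival proofs inhabit the same negation and are
    -- definitionally equal.
    lemma refl = refl

  -- Endpoints of edges in `H₁` have the form `σ₁.to y` only up to a proved equation, so the
  -- exchange must be computed along it.
  exchange-at : ∀ {x n} y (eq : x ≡ σ₁.to y) →
    exchange (inj₁ (x , n)) ≡
    exchangeKept y (subst (¬_ ∘ ImageOutside σ₂.i ρ₁.residual) eq n)
  exchange-at y refl = exchange-to y _

  -- As `σ₁.to` is surjective, a kept item of `H₁` may be assumed to come from the constructed
  -- result, where `exchange` computes.
  elim : (P : From → Set) → (∀ y n → P (inj₁ (σ₁.to y , n))) →
         (∀ w → P (inj₂ w)) → ∀ z → P z
  elim P kept added (inj₂ w)       = added w
  elim P kept added (inj₁ (x , n)) = lemma (σ₁.to-from x)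
    where
    lemma : ∀ {y} → σ₁.to y ≡ x → P (inj₁ (x , n))
    lemma refl = kept _ n

  -- An added edge receives its endpoints through the comatch of its rule. Compatibility of the
  -- exchange with sources and targets therefore needs the comatches of each rule in the two orders
  -- to correspond; this settles the first rule and `exchange-comatch₂` the second.
  exchange-comatch₁ : {h : σ₁.R → To} → IsComatch σ₁.i σ₁.j ρ₂.residual h →
                      ∀ w {x} n → x ≡ σ₁.to (σ₁.h w) →
                      exchange (inj₁ (x , n)) ≡ h w
  exchange-comatch₁ {h} h-comatch w n refl =
    trans (exchange-to (σ₁.h w) n) (kept-h n)
    where
    module h = IsComatch h-comatch

    kept-h : ∀ n → exchangeKept (σ₁.h w) n ≡ h w
    kept-h n with σ₁.j? w
    ... | yes (k , refl) rewrite σ₁.on-K k = sym (h.on-K k)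
    ... | no w∉K rewrite σ₁.off-K w∉K = sym (h.off-K w∉K)

  exchange-comatch₂ : {h : σ₂.R → From} → IsComatch σ₂.i σ₂.j ρ₁.residual h →
                      ∀ w {x} n → x ≡ σ₂.to (σ₂.h w) →
                      exchange (h w) ≡ inj₁ (x , n)
  exchange-comatch₂ {h} h-comatch w n refl with σ₂.j? w
  ... | yes (k , refl) = trans (cong exchange (h.on-K k))
          (trans (exchange-to _ (image-kept h.g-injective k))
            (inj₁-≡ {j = σ₁.j} (cong σ₂.to (sym (σ₂.on-K k)))))
    where module h = IsComatch h-comatch
  ... | no w∉K = trans (cong exchange (h.off-K w∉K))
          (inj₁-≡ {j = σ₁.j} (cong σ₂.to (sym (σ₂.off-K w∉K))))
    where module h = IsComatch h-comatch

-- The exchange only retags items: those kept by both rules stay kept, while those added by one rule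
-- switch between the kept and the added side. Swapping the roles of the steps undoes this.
exchange-involutive :
  (σ₁ : Step G H₁) (σ₂ : Step G H₂) (ind : Independent σ₁ σ₂) → ∀ z →
  Exchange.exchange σ₂ σ₁ (Independent-sym {σ₁ = σ₁} {σ₂ = σ₂} ind)
    (Exchange.exchange σ₁ σ₂ ind z) ≡ z
exchange-involutive σ₁ σ₂ ind =
  X₁.elim _ kept (λ w → X₂.exchange-to (inj₂ w) R₂.added-kept)
  where
  module X₁ = Exchange σ₁ σ₂ ind
  module X₂ = Exchange σ₂ σ₁ (Independent-sym {σ₁ = σ₁} {σ₂ = σ₂} ind)
  module R₁ = Residual σ₁ σ₂ ind
  module R₂ = Residual σ₂ σ₁ (Independent-sym {σ₁ = σ₁} {σ₂ = σ₂} ind)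

  kept : ∀ y n → X₂.exchange (X₁.exchange (inj₁ (Step.to σ₁ y , n))) ≡
                 inj₁ (Step.to σ₁ y , n)
  kept (inj₁ (x , n₁)) n =
    trans (cong X₂.exchange (X₁.exchange-to (inj₁ (x , n₁)) n))
          (X₂.exchange-to (inj₁ (x , n₂)) (R₂.kept-after n₂ n₁))
    where n₂ = R₁.kept-before n₁ n
  kept (inj₂ w) n = cong X₂.exchange (X₁.exchange-to (inj₂ w) n)

-- Graphs

open TLRG using (graph)

-- Sources and targets, and likewise labels and rootedness below, obey the same arguments; an index
-- lets each argument be given once.
data End : Set where
  source target : End

end : (G : Graph ℒ) → End → Graph.E G → Graph.V G
end G source = Graph.s G
end G target = Graph.t G

data Attribute : Set where
  label root : Attribute

Value : LabelAlphabet → Attribute → Set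
Value ℒ label = NodeLabel ℒ
Value ℒ root  = Bool

attr : (G : Graph ℒ) (α : Attribute) → Graph.V G → Maybe (Value ℒ α)
attr G label = Graph.l G
attr G root  = Graph.p G

values : {G : Graph ℒ} → Part G → ∀ α → REL (Graph.V G) (Value ℒ α) 0ℓ
values P label = labels P
values P root  = roots P

attr-total : (G : TLRG ℒ) → ∀ α v → ∃ λ a → attr (graph G) α v ≡ just a
attr-total G α v with attr (graph G) α v in eq | total α v
  where
  total : ∀ α v → Is-just (attr (graph G) α v)
  total label = TLRG.l-total G
  total root  = TLRG.p-total G
... | just a | _ = a , refl

mkTLRG : (G : Graph ℒ) → (∀ α v → ∃ λ a → attr G α v ≡ just a) → TLRG ℒ
mkTLRG G total = record
  { graph   = G
  ; l-total = λ v → defined (total label v)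
  ; p-total = λ v → defined (total root v)
  }
  where
  defined : {x : Maybe A} → (∃ λ a → x ≡ just a) → Is-just x
  defined (_ , refl) = just tt

≅-refl : {G : Graph ℒ} → G ≅ G
≅-refl = record
  { to = idₘ ; from = idₘ
  ; to-fromV = λ _ → refl ; from-toV = λ _ → refl
  ; to-fromE = λ _ → refl ; from-toE = λ _ → refl
  }
  where
  idₘ = record
    { onV = id ; onE = id
    ; preserves-s = λ _ → refl
    ; preserves-t = λ _ → refl
    ; preserves-m = λ _ → refl
    ; preserves-l = id
    ; preserves-p = id
    }

module _ {G H : Graph ℒ} (f : Morphism G H) where
  preserves-end : ∀ ς e → end H ς (onE f e) ≡ onV f (end G ς e)
  preserves-end source = preserves-s f
  preserves-end target = preserves-t f

  preserves-attr : ∀ α {v a} → attr G α v ≡ just a → attr H α (onV f v) ≡ just a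
  preserves-attr label = preserves-l f
  preserves-attr root  = preserves-p f

  image-values⁺ : ∀ α {v a} → (∃ λ x → onV f x ≡ v × attr G α x ≡ just a) →
                  values (image f) α v a
  image-values⁺ label = id
  image-values⁺ root  = id

  image-values⁻ : ∀ α {v a} → values (image f) α v a →
                  ∃ λ x → onV f x ≡ v × attr G α x ≡ just a
  image-values⁻ label = id
  image-values⁻ root  = id

mkMorphism : {G H : Graph ℒ} (fV : Graph.V G → Graph.V H)
  (fE : Graph.E G → Graph.E H) →
  (∀ ς e → end H ς (fE e) ≡ fV (end G ς e)) →
  (∀ e → Graph.m H (fE e) ≡ Graph.m G e) →
  (∀ α {v a} → attr G α v ≡ just a → attr H α (fV v) ≡ just a) →
  Morphism G H
mkMorphism fV fE f-end f-m f-attr = record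
  { onV = fV ; onE = fE
  ; preserves-s = f-end source
  ; preserves-t = f-end target
  ; preserves-m = f-m
  ; preserves-l = f-attr label
  ; preserves-p = f-attr root
  }

-- A morphism preserves defined values only. Undefinedness is preserved here because a value in `H`
-- would be carried back by the inverse.
≅-attr : {G H : Graph ℒ} (φ : G ≅ H) → ∀ α v →
         attr H α (onV (_≅_.to φ) v) ≡ attr G α v
≅-attr {G = G} {H = H} φ α v
  with attr G α v in eqG | attr H α (onV (_≅_.to φ) v) in eqH
... | just a  | _       = trans (sym eqH) (preserves-attr (_≅_.to φ) α eqG)
... | nothing | nothing = refl
... | nothing | just b  = trans (sym (preserves-attr (_≅_.from φ) α eqH))
        (trans (cong (attr G α) (_≅_.from-toV φ v)) eqG)

-- Endpoints and attributes after one rule application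

module MatchProperties {r : Rule ℒ} {G : TLRG ℒ} (match : Match r G) where
  open Rule r
  open Match match
  open Apply match
  private
    module G = TLRG G

  gK-injective : Injective _≡_ _≡_ (onV gK)
  gK-injective = proj₁ inL-injective ∘ proj₁ g-injective

  node-comatch : IsComatch (onV inL) (onV inR) (onV g) hV
  node-comatch = record
    { g-injective = proj₁ g-injective
    ; j?          = image? K.V-finite R.V-finite (onV inR)
    ; on-K        = hV-inR
    ; off-K       = off-K
    }
    where
    off-K : ∀ {w} (w∉K : ¬ Image (onV inR) w) → hV w ≡ inj₂ (w , w∉K)
    off-K {w} w∉K with image? K.V-finite R.V-finite (onV inR) w
    ... | yes w∈K = ⊥-elim (w∉K w∈K)
    ... | no _    = refl

  edge-comatch : IsComatch (onE inL) (onE inR) (onE g) hE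
  edge-comatch = record
    { g-injective = proj₂ g-injective
    ; j?          = image? K.E-finite R.E-finite (onE inR)
    ; on-K        = on-K
    ; off-K       = off-K
    }
    where
    on-K : ∀ k → hE (onE inR k) ≡ inj₁ (dE k)
    on-K k with image? K.E-finite R.E-finite (onE inR) (onE inR k)
    ... | yes (_ , eq) = cong (inj₁ ∘ dE) (proj₂ inR-injective eq)
    ... | no k∉K       = ⊥-elim (k∉K (k , refl))

    off-K : ∀ {e} (e∉K : ¬ Image (onE inR) e) → hE e ≡ inj₂ (e , e∉K)
    off-K {e} e∉K with image? K.E-finite R.E-finite (onE inR) e
    ... | yes e∈K = ⊥-elim (e∉K e∈K)
    ... | no _    = refl

  kept-end : ∀ ς {e} → ¬ DeletedE e → ¬ DeletedV (end G.graph ς e)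
  kept-end source kept = proj₂ (Graph.s remainder (_ , kept))
  kept-end target kept = proj₂ (Graph.t remainder (_ , kept))

  result-end-kept : ∀ ς e (kept : ¬ DeletedE e) →
    end result ς (inj₁ (e , kept)) ≡ inj₁ (end G.graph ς e , kept-end ς kept)
  result-end-kept source e kept = refl
  result-end-kept target e kept = refl

  result-end-added : ∀ ς e → end result ς (inj₂ e) ≡ hV (end R.graph ς (proj₁ e))
  result-end-added source e = refl
  result-end-added target e = refl

  dangling-end : ∀ ς e → ¬ Image (onE g) e → ¬ DeletedV (end G.graph ς e)
  dangling-end source e = proj₁ ∘ dangling e
  dangling-end target e = proj₂ ∘ dangling e

  -- A rule overwrites an attribute of a preserved node exactly where its interface leaves it
  -- undefined. `Unchanged` below also covers the nodes outside the image of K.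
  Relabelled : Attribute → G.V → Set
  Relabelled α x = ∃ λ k → onV gK k ≡ x × attr K α k ≡ nothing

  Unchanged : Attribute → G.V → Set
  Unchanged α x = ∀ {k} → onV gK k ≡ x → attr K α k ≢ nothing

  relabelled-or-unchanged : ∀ α x → Relabelled α x ⊎ Unchanged α x
  relabelled-or-unchanged α x with onK? x
  ... | no x∉K = inj₂ λ eq _ → x∉K (_ , eq)
  ... | yes (k , refl) with attr K α k in k↦
  ...   | nothing = inj₁ (k , refl , k↦)
  -- By injectivity any preimage of the node is this `k`, so its defined value decides the matter.
  ...   | just a  = inj₂ λ eq k′↦ → just≢nothing
            (trans (sym k↦) (trans (cong (attr K α) (sym (gK-injective eq))) k′↦))
    where
    just≢nothing : {a : A} → just a ≢ nothing
    just≢nothing ()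

  paste-unchanged :
    (attrK : K.V → Maybe A) (attrR : R.V → Maybe A) (attrG : G.V → Maybe A) →
    ∀ x → (∀ {k} → onV gK k ≡ proj₁ x → attrK k ≢ nothing) →
    paste attrK attrR (cut attrK attrG) (inj₁ x) ≡ attrG (proj₁ x)
  -- After `paste` has branched on `onK?`, `cut` repeats the same decision; the saved equation `on?`
  -- resolves that second occurrence.
  paste-unchanged attrK attrR attrG x unchanged with onK? (proj₁ x) in on?
  ... | no _ rewrite on? = refl
  ... | yes (k , eq) with attrK k in k↦
  ...   | nothing = ⊥-elim (unchanged eq k↦)
  ...   | just _ rewrite on? | k↦ = refl

  paste-relabelled :
    (attrK : K.V → Maybe A) (attrR : R.V → Maybe A) (attrG : G.V → Maybe A) →
    ∀ {x k} → onV gK k ≡ proj₁ x → attrK k ≡ nothing →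
    paste attrK attrR (cut attrK attrG) (inj₁ x) ≡ attrR (onV inR k)
  paste-relabelled attrK attrR attrG {x} {k} refl k↦ =
    trans (paste-dV attrK attrR (cut attrK attrG) k)
          (cong (λ a → if is-just a then cut attrK attrG x else attrR (onV inR k)) k↦)

  result-unchanged : ∀ α x → Unchanged α (proj₁ x) →
    attr result α (inj₁ x) ≡ attr G.graph α (proj₁ x)
  result-unchanged label = paste-unchanged K.l R.l G.l
  result-unchanged root  = paste-unchanged K.p R.p G.p

  result-relabelled : ∀ α {x k} → onV gK k ≡ proj₁ x → attr K α k ≡ nothing →
    attr result α (inj₁ x) ≡ attr R.graph α (onV inR k)
  result-relabelled label = paste-relabelled K.l R.l G.l
  result-relabelled root  = paste-relabelled K.p R.p G.p

  result-added : ∀ α w → attr result α (inj₂ w) ≡ attr R.graph α (proj₁ w)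
  result-added label w = refl
  result-added root  w = refl

  -- Every value in the result is copied from `G` or from `R`, and both are total.
  result-total : ∀ α v → ∃ λ a → attr result α v ≡ just a
  result-total α (inj₂ w) =
    let a , eq = attr-total R α (proj₁ w) in a , trans (result-added α w) eq
  result-total α (inj₁ x) with relabelled-or-unchanged α (proj₁ x)
  ... | inj₁ (k , gk≡ , k↦) =
    let a , eq = attr-total R α (onV inR k)
    in  a , trans (result-relabelled α gk≡ k↦) eq
  ... | inj₂ unchanged =
    let a , eq = attr-total G α (proj₁ x)
    in  a , trans (result-unchanged α x unchanged) eq

resultTLRG : {r : Rule ℒ} {G : TLRG ℒ} → Match r G → TLRG ℒ
resultTLRG match = mkTLRG (Apply.result match) (MatchProperties.result-total match)

module _ {r : Rule ℒ} {G H : TLRG ℒ} (δ : G ⇒[ r ] H) where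
  open _⇒[_]_ δ
  open _≅_ iso

  nodeStep : Step (TLRG.V G) (TLRG.V H)
  nodeStep = record
    { isComatch = MatchProperties.node-comatch match
    ; to        = onV to
    ; from      = onV from
    ; to-from   = to-fromV
    ; from-to   = from-toV
    }

  edgeStep : Step (TLRG.E G) (TLRG.E H)
  edgeStep = record
    { isComatch = MatchProperties.edge-comatch match
    ; to        = onE to
    ; from      = onE from
    ; to-from   = to-fromE
    ; from-to   = from-toE
    }

module DerivationProperties {r : Rule ℒ} {G H : TLRG ℒ} (δ : G ⇒[ r ] H) where
  open _⇒[_]_ δ
  open MatchProperties match
  open Apply match using (result; hV)
  open Match match using (DeletedE)
  open _≅_ iso using (to)

  end-kept : ∀ ς x (kept : ¬ DeletedE x) →
    end (graph H) ς (onE to (inj₁ (x , kept))) ≡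
    onV to (inj₁ (end (graph G) ς x , kept-end ς kept))
  end-kept ς x kept =
    trans (preserves-end to ς _) (cong (onV to) (result-end-kept ς x kept))

  end-added : ∀ ς w → end (graph H) ς (onE to (inj₂ w)) ≡
                      onV to (hV (end (Rule.R.graph r) ς (proj₁ w)))
  end-added ς w =
    trans (preserves-end to ς _) (cong (onV to) (result-end-added ς w))

⊑-values : {G : Graph ℒ} {P Q P′ Q′ : Part G} → P ⊓ Q ⊑ P′ ⊓ Q′ → ∀ α {v a} →
           values P α v a → values Q α v a → values P′ α v a × values Q′ α v a
⊑-values (_ , _ , ⊑-l , _) label x y = ⊑-l (x , y)
⊑-values (_ , _ , _ , ⊑-p) root  x y = ⊑-p (x , y)

mk⊑ : {G : Graph ℒ} {P Q P′ Q′ : Part G} →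
      nodes P ∩ nodes Q ⊆ nodes P′ ∩ nodes Q′ →
      edges P ∩ edges Q ⊆ edges P′ ∩ edges Q′ →
      (∀ α {v a} → values P α v a → values Q α v a →
       values P′ α v a × values Q′ α v a) →
      P ⊓ Q ⊑ P′ ⊓ Q′
mk⊑ ⊑-V ⊑-E ⊑-attr = ⊑-V , ⊑-E ,
  (λ (x , y) → ⊑-attr label x y) , (λ (x , y) → ⊑-attr root x y)

ParallelIndependent-sym : {r₁ r₂ : Rule ℒ} {G H₁ H₂ : TLRG ℒ}
  (δ₁ : G ⇒[ r₁ ] H₁) (δ₂ : G ⇒[ r₂ ] H₂) →
  ParallelIndependent δ₁ δ₂ → ParallelIndependent δ₂ δ₁
ParallelIndependent-sym δ₁ δ₂ (ind-V , ind-E , ind-l , ind-p) =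
  (λ p → swap (ind-V (swap p))) , (λ p → swap (ind-E (swap p))) ,
  (λ p → swap (ind-l (swap p))) , (λ p → swap (ind-p (swap p)))

-- Residual matches of graphs and sequential independence

module GraphResidual {r₁ r₂ : Rule ℒ} {G H₁ H₂ : TLRG ℒ}
                     (δ₁ : G ⇒[ r₁ ] H₁) (δ₂ : G ⇒[ r₂ ] H₂)
                     (ind : ParallelIndependent δ₁ δ₂) where
  private
    module r₁ = Rule r₁
    module r₂ = Rule r₂
    module δ₁ = _⇒[_]_ δ₁
    module δ₂ = _⇒[_]_ δ₂
    module M₁ = MatchProperties δ₁.match
    module M₂ = MatchProperties δ₂.match
    module D₁ = DerivationProperties δ₁
    module σ₁ = Step (nodeStep δ₁)
    module σ₂ = Step (nodeStep δ₂)
    open _≅_ δ₁.iso using (to; to-fromE)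

  module ResidualV = Residual (nodeStep δ₁) (nodeStep δ₂) (proj₁ ind)
  module ResidualE = Residual (edgeStep δ₁) (edgeStep δ₂) (proj₁ (proj₂ ind))

  -- Totality of L₁ gives a value at `x`, which must be `a` because both matches preserve values
  -- into the same node of `G`. The value thus lies in both images, and independence places it in
  -- both interfaces.
  shared-attr : ∀ α {x v a} → onV δ₁.g x ≡ onV δ₂.g v →
    attr r₂.L.graph α v ≡ just a →
    (∃ λ k → onV (δ₁.g ∘ₘ r₁.inL) k ≡ onV δ₂.g v × attr r₁.K α k ≡ just a) ×
    (∃ λ k → onV (δ₂.g ∘ₘ r₂.inL) k ≡ onV δ₂.g v × attr r₂.K α k ≡ just a)
  shared-attr α {x} {v} {a} eq v↦ =
    let b , x↦ = attr-total r₁.L α x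
        b≡a = trans (sym (preserves-attr δ₁.g α x↦))
                (trans (cong (attr (graph G) α) eq) (preserves-attr δ₂.g α v↦))
        k₁ , k₂ = ⊑-values {P = image δ₁.g} {Q = image δ₂.g} ind α
          (image-values⁺ δ₁.g α (x , eq , trans x↦ b≡a))
          (image-values⁺ δ₂.g α (v , refl , v↦))
    in  image-values⁻ (δ₁.g ∘ₘ r₁.inL) α k₁ , image-values⁻ (δ₂.g ∘ₘ r₂.inL) α k₂

  -- Relabelling by the first rule would need K₁ to be undefined at this node, but L₂ is total, so
  -- `shared-attr` yields a value there.
  shared-unchanged : ∀ α {x} → Image (onV δ₂.g) x → M₁.Unchanged α x
  shared-unchanged α (v , refl) gk≡ k↦ =
    let _ , v↦ = attr-total r₂.L α v
        (k′ , gk′≡ , k′↦) , _ = shared-attr α gk≡ v↦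
        k≡k′ = M₁.gK-injective (trans gk≡ (sym gk′≡))
    in  nothing≢just (trans (sym k↦) (trans (cong (attr r₁.K α) k≡k′) k′↦))
    where
    nothing≢just : {a : A} → nothing ≢ just a
    nothing≢just ()

  residual-morphism : Morphism r₂.L.graph (graph H₁)
  residual-morphism = mkMorphism ResidualV.residual ResidualE.residual
    (λ ς e → trans (D₁.end-kept ς _ _)
      (cong (onV to ∘ inj₁) (≡-¬ (preserves-end δ₂.g ς e))))
    (λ e → trans (preserves-m to _) (preserves-m δ₂.g e))
    (λ α v↦ → preserves-attr to α
      (trans (M₁.result-unchanged α _ (shared-unchanged α (_ , refl)))
             (preserves-attr δ₂.g α v↦)))

  -- For an old edge this is the dangling condition of the second match in `G`. An edge added by the
  -- first rule has its endpoints in the comatch image, and by `comatch-overlap` any such node met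
  -- by `residual` comes from K₂, so it is not deleted.
  residual-dangling : ∀ ς e → ¬ Image ResidualE.residual e →
    ¬ ImageOutside (onV r₂.inL) ResidualV.residual (end (graph H₁) ς e)
  residual-dangling ς e e∉ =
    subst (¬_ ∘ ImageOutside _ _ ∘ end (graph H₁) ς) (to-fromE e)
      (dangling-to _ (subst (¬_ ∘ Image _) (sym (to-fromE e)) e∉))
    where
    dangling-to : ∀ y → ¬ Image ResidualE.residual (onE to y) →
      ¬ ImageOutside (onV r₂.inL) ResidualV.residual (end (graph H₁) ς (onE to y))
    dangling-to (inj₁ (x , n)) y∉ (v , v∉K , eq) =
      M₂.dangling-end ς x
        (λ (e₂ , ge₂≡) → y∉ (e₂ , ResidualE.residual-kept⁻ ge₂≡))
        (v , v∉K , ResidualV.residual-kept (trans eq (D₁.end-kept ς x n)))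
    dangling-to (inj₂ w) _ (v , v∉K , eq) =
      let _ , _ , _ , v∈K = ResidualV.comatch-overlap
                            (sym (trans eq (D₁.end-added ς w)))
      in  v∉K v∈K

  residual-match : Match r₂ H₁
  residual-match = record
    { g           = residual-morphism
    ; g-injective = ResidualV.residual-injective , ResidualE.residual-injective
    ; dangling    = λ e e∉ →
        residual-dangling source e e∉ , residual-dangling target e e∉
    }

  -- The isomorphism is arbitrary so that the lemma serves both orders: `≅-refl` in one and
  -- `exchange-iso` in the other.
  residual-independent : {G′ : TLRG ℒ}
    (iso : Apply.result residual-match ≅ graph G′) →
    SequentiallyIndependent {G₂ = G′} δ₁ (record { match = residual-match ; iso = iso })
  residual-independent _ = mk⊑
    {P = image h₁} {Q = image g₂}
    {P′ = image (h₁ ∘ₘ r₁.inR)} {Q′ = image (g₂ ∘ₘ r₂.inL)}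
    (λ ((w , hw≡) , (v , gv≡)) →
      let k₁ , k₁≡ , _ , k₂ , k₂≡ = ResidualV.comatch-overlap (trans hw≡ (sym gv≡))
      in  (k₁ , trans (cong (onV h₁) k₁≡) hw≡) , (k₂ , trans (cong (onV g₂) k₂≡) gv≡))
    (λ ((w , hw≡) , (v , gv≡)) →
      let k₁ , k₁≡ , _ , k₂ , k₂≡ = ResidualE.comatch-overlap (trans hw≡ (sym gv≡))
      in  (k₁ , trans (cong (onE h₁) k₁≡) hw≡) , (k₂ , trans (cong (onE g₂) k₂≡) gv≡))
    overlap-attr
    where
    h₁ = δ₁.comatch
    g₂ = residual-morphism

    overlap-attr : ∀ α {v a} → values (image h₁) α v a → values (image g₂) α v a →
      values (image (h₁ ∘ₘ r₁.inR)) α v a × values (image (g₂ ∘ₘ r₂.inL)) α v a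
    overlap-attr α p q =
      let w , hw≡ , _  = image-values⁻ h₁ α p
          v , gv≡ , v↦ = image-values⁻ g₂ α q
          _ , _ , gk≡ , _ = ResidualV.comatch-overlap (trans hw≡ (sym gv≡))
          -- The overlap lies over a node of `G` matched by both rules, so the value known from L₂
          -- is already defined in both interfaces.
          (k₁ , k₁≡ , k₁↦) , (k₂ , k₂≡ , k₂↦) = shared-attr α gk≡ v↦
      in  image-values⁺ (h₁ ∘ₘ r₁.inR) α
            (k₁ , trans (cong (onV to) (σ₁.on-K k₁))
                    (trans (sym (ResidualV.residual-kept⁻ (sym k₁≡))) gv≡) , k₁↦)
        , image-values⁺ (g₂ ∘ₘ r₂.inL) α
            (k₂ , trans (cong ResidualV.residual (σ₂.g-injective k₂≡)) gv≡ , k₂↦)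

-- Endpoints and attributes under the exchange

module GraphExchange {r₁ r₂ : Rule ℒ} {G H₁ H₂ : TLRG ℒ}
                     (δ₁ : G ⇒[ r₁ ] H₁) (δ₂ : G ⇒[ r₂ ] H₂)
                     (ind : ParallelIndependent δ₁ δ₂) where
  private
    module r₁ = Rule r₁
    module r₂ = Rule r₂
    module δ₁ = _⇒[_]_ δ₁
    module δ₂ = _⇒[_]_ δ₂
    module M₁ = MatchProperties δ₁.match
    module M₂ = MatchProperties δ₂.match
    module D₁ = DerivationProperties δ₁
    module D₂ = DerivationProperties δ₂
    module ρ₁ = GraphResidual δ₁ δ₂ ind
    module ρ₂ = GraphResidual δ₂ δ₁ (ParallelIndependent-sym δ₁ δ₂ ind)
    module M₂′ = MatchProperties ρ₁.residual-match
    module M₁′ = MatchProperties ρ₂.residual-match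
    module A₂′ = Apply ρ₁.residual-match
    module A₁′ = Apply ρ₂.residual-match
    to₁ = _≅_.to δ₁.iso
    to₂ = _≅_.to δ₂.iso

  module XV = Exchange (nodeStep δ₁) (nodeStep δ₂) (proj₁ ind)
  module XE = Exchange (edgeStep δ₁) (edgeStep δ₂) (proj₁ (proj₂ ind))

  -- An edge kept by both rules has endpoints kept by both. For an edge added by either rule the
  -- endpoints are values of a comatch, which the exchange respects.
  exchange-end : ∀ ς e → end A₁′.result ς (XE.exchange e) ≡
                         XV.exchange (end A₂′.result ς e)
  exchange-end ς = XE.elim _ kept added
    where
    kept : ∀ y n → end A₁′.result ς (XE.exchange (inj₁ (onE to₁ y , n))) ≡
                   XV.exchange (end A₂′.result ς (inj₁ (onE to₁ y , n)))
    kept y n = trans (cong (end A₁′.result ς) (XE.exchange-to y n))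
      (trans (kept-to y n)
        (cong XV.exchange (sym (M₂′.result-end-kept ς (onE to₁ y) n))))
      where
      kept-to : ∀ y n → end A₁′.result ς (XE.exchangeKept y n) ≡
                XV.exchange (inj₁ (end (graph H₁) ς (onE to₁ y) , M₂′.kept-end ς n))
      kept-to (inj₂ w) n = trans (M₁′.result-end-added ς w)
        (sym (XV.exchange-comatch₁ M₁′.node-comatch _
               (M₂′.kept-end ς n) (D₁.end-added ς w)))
      kept-to (inj₁ (x , n₁)) n =
        trans (M₁′.result-end-kept ς _ keptE)
          (trans (inj₁-≡ {j = onV r₁.inR} (D₂.end-kept ς x n₂))
            (sym (XV.exchange-at {n = M₂′.kept-end ς n}
                   (inj₁ (_ , M₁.kept-end ς n₁)) (D₁.end-kept ς x n₁))))
        where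
        n₂    = ρ₁.ResidualE.kept-before n₁ n
        keptE = ρ₂.ResidualE.kept-after n₂ n₁

    added : ∀ w → end A₁′.result ς (XE.exchange (inj₂ w)) ≡
                  XV.exchange (end A₂′.result ς (inj₂ w))
    added w = trans (M₁′.result-end-kept ς _ ρ₂.ResidualE.added-kept)
      (sym (trans (cong XV.exchange (M₂′.result-end-added ς w))
        (XV.exchange-comatch₂ M₂′.node-comatch _
          (M₁′.kept-end ς ρ₂.ResidualE.added-kept) (D₂.end-added ς w))))

  exchange-m : ∀ e → Graph.m A₁′.result (XE.exchange e) ≡ Graph.m A₂′.result e
  exchange-m = XE.elim _
    (λ y n → trans (cong (Graph.m A₁′.result) (XE.exchange-to y n)) (kept y n))
    (λ w → preserves-m to₂ (inj₂ w))
    where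
    kept : ∀ y n → Graph.m A₁′.result (XE.exchangeKept y n) ≡ TLRG.m H₁ (onE to₁ y)
    kept (inj₁ (x , n₁)) n = trans (preserves-m to₂ _) (sym (preserves-m to₁ _))
    kept (inj₂ w)        n = sym (preserves-m to₁ (inj₂ w))

  -- A node of g₂(K₂) is matched by the second rule, so the first cannot relabel it. Hence no
  -- attribute of a node is overwritten by both rules.
  unchanged₂ : ∀ α {x} → M₁.Relabelled α x → M₂.Unchanged α x
  unchanged₂ α (k , gk≡ , k↦) gk₂≡ _ =
    ρ₁.shared-unchanged α (_ , gk₂≡) gk≡ k↦

  unchanged₂′ : ∀ α {x} n → M₂.Unchanged α x → M₂′.Unchanged α (onV to₁ (inj₁ (x , n)))
  unchanged₂′ α n unchanged gk≡ = unchanged (ρ₁.ResidualV.residual-kept {n = n} gk≡)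

  -- This and the next three lemmas trace each attribute inherited from `H₁` to its origin in `G`,
  -- R₁ or R₂. With the roles of the rules swapped they describe the other order.
  attr-added : ∀ α w {n} →
    attr A₂′.result α (inj₁ (onV to₁ (inj₂ w) , n)) ≡ attr r₁.R.graph α (proj₁ w)
  attr-added α w = trans
    (M₂′.result-unchanged α _ (λ gk≡ _ → ρ₁.ResidualV.residual-added gk≡))
    (trans (≅-attr δ₁.iso α (inj₂ w)) (M₁.result-added α w))

  attr-unchanged : ∀ α x n {m} → M₁.Unchanged α x → M₂.Unchanged α x →
    attr A₂′.result α (inj₁ (onV to₁ (inj₁ (x , n)) , m)) ≡ attr (graph G) α x
  attr-unchanged α x n u₁ u₂ = trans
    (M₂′.result-unchanged α _ (unchanged₂′ α n u₂))
    (trans (≅-attr δ₁.iso α _) (M₁.result-unchanged α (x , n) u₁))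

  attr-relabelled₁ : ∀ α x n {m} ((k , _) : M₁.Relabelled α x) →
    attr A₂′.result α (inj₁ (onV to₁ (inj₁ (x , n)) , m)) ≡
    attr r₁.R.graph α (onV r₁.inR k)
  attr-relabelled₁ α x n rel@(k , gk≡ , k↦) = trans
    (M₂′.result-unchanged α _ (unchanged₂′ α n (unchanged₂ α rel)))
    (trans (≅-attr δ₁.iso α _) (M₁.result-relabelled α gk≡ k↦))

  attr-relabelled₂ : ∀ α x n {m} ((k , _) : M₂.Relabelled α x) →
    attr A₂′.result α (inj₁ (onV to₁ (inj₁ (x , n)) , m)) ≡
    attr r₂.R.graph α (onV r₂.inR k)
  attr-relabelled₂ α x n (k , gk≡ , k↦) =
    M₂′.result-relabelled α (ρ₁.ResidualV.residual-kept⁻ gk≡) k↦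

-- Isomorphism of the two results

module GraphExchangeIso {r₁ r₂ : Rule ℒ} {G H₁ H₂ : TLRG ℒ}
                     (δ₁ : G ⇒[ r₁ ] H₁) (δ₂ : G ⇒[ r₂ ] H₂)
                     (ind : ParallelIndependent δ₁ δ₂) where
  private
    module M₁ = MatchProperties (_⇒[_]_.match δ₁)
    module M₂ = MatchProperties (_⇒[_]_.match δ₂)
    module X₁ = GraphExchange δ₁ δ₂ ind
    module X₂ = GraphExchange δ₂ δ₁ (ParallelIndependent-sym δ₁ δ₂ ind)
    module ρ₁ = GraphResidual δ₁ δ₂ ind
    module ρ₂ = GraphResidual δ₂ δ₁ (ParallelIndependent-sym δ₁ δ₂ ind)
    result₂ = Apply.result ρ₁.residual-match
    result₁ = Apply.result ρ₂.residual-match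

  -- In both orders an attribute comes from the rule that adds or relabels the node, and from `G` if
  -- neither does; since at most one rule relabels, the order is immaterial.
  exchange-attr : ∀ α v → attr result₁ α (X₁.XV.exchange v) ≡ attr result₂ α v
  exchange-attr α = X₁.XV.elim _
    (λ y n → trans (cong (attr result₁ α) (X₁.XV.exchange-to y n)) (kept y n))
    (λ w → trans (X₂.attr-added α w)
      (sym (MatchProperties.result-added ρ₁.residual-match α w)))
    where
    kept : ∀ y n → attr result₁ α (X₁.XV.exchangeKept y n) ≡
                   attr result₂ α (inj₁ (onV (_≅_.to (_⇒[_]_.iso δ₁)) y , n))
    kept (inj₂ w) n = trans (MatchProperties.result-added ρ₂.residual-match α w)
                            (sym (X₁.attr-added α w))
    kept (inj₁ (x , n₁)) n
      with M₁.relabelled-or-unchanged α x | M₂.relabelled-or-unchanged α x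
    ... | inj₁ rel₁ | _         = trans (X₂.attr-relabelled₂ α x _ rel₁)
                                        (sym (X₁.attr-relabelled₁ α x n₁ rel₁))
    ... | inj₂ _    | inj₁ rel₂ = trans (X₂.attr-relabelled₁ α x _ rel₂)
                                        (sym (X₁.attr-relabelled₂ α x n₁ rel₂))
    ... | inj₂ u₁   | inj₂ u₂   = trans (X₂.attr-unchanged α x _ u₂ u₁)
                                        (sym (X₁.attr-unchanged α x n₁ u₁ u₂))

  exchange-morphism : Morphism result₂ result₁
  exchange-morphism = mkMorphism X₁.XV.exchange X₁.XE.exchange
    X₁.exchange-end X₁.exchange-m (λ α v↦ → trans (exchange-attr α _) v↦)

-- The exchanges in the two directions are mutually inverse. The types fit because symmetrising
-- independence twice is definitionally the identity.
exchange-iso : {r₁ r₂ : Rule ℒ} {G H₁ H₂ : TLRG ℒ}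
  (δ₁ : G ⇒[ r₁ ] H₁) (δ₂ : G ⇒[ r₂ ] H₂) (ind : ParallelIndependent δ₁ δ₂) →
  Apply.result (GraphResidual.residual-match δ₂ δ₁ (ParallelIndependent-sym δ₁ δ₂ ind)) ≅
  Apply.result (GraphResidual.residual-match δ₁ δ₂ ind)
exchange-iso δ₁ δ₂ ind = record
  { to       = GraphExchangeIso.exchange-morphism δ₂ δ₁ ind′
  ; from     = GraphExchangeIso.exchange-morphism δ₁ δ₂ ind
  ; to-fromV = exchange-involutive (nodeStep δ₁) (nodeStep δ₂) (proj₁ ind)
  ; from-toV = exchange-involutive (nodeStep δ₂) (nodeStep δ₁) (proj₁ ind′)
  ; to-fromE = exchange-involutive (edgeStep δ₁) (edgeStep δ₂) (proj₁ (proj₂ ind))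
  ; from-toE = exchange-involutive (edgeStep δ₂) (edgeStep δ₁) (proj₁ (proj₂ ind′))
  }
  where ind′ = ParallelIndependent-sym δ₁ δ₂ ind

theorem6p3 : ∀ {ℒ : LabelAlphabet} {r₁ r₂ : Rule ℒ} {G H₁ H₂ : TLRG ℒ}
    (δ₁ : G ⇒[ r₁ ] H₁) (δ₂ : G ⇒[ r₂ ] H₂) →
    ParallelIndependent δ₁ δ₂ →
    Σ[ G′ ∈ TLRG ℒ ] Σ[ ε₂ ∈ H₁ ⇒[ r₂ ] G′ ] Σ[ ε₁ ∈ H₂ ⇒[ r₁ ] G′ ]
    SequentiallyIndependent δ₁ ε₂ × SequentiallyIndependent δ₂ ε₁
theorem6p3 δ₁ δ₂ ind =
  -- `G′` is the constructed result of the order r₁, r₂, so only the other order needs a nontrivial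
  -- identification.
  G′ ,
  record { match = ρ₁.residual-match ; iso = ≅-refl } ,
  record { match = ρ₂.residual-match ; iso = exchange-iso δ₁ δ₂ ind } ,
  ρ₁.residual-independent {G′ = G′} ≅-refl ,
  ρ₂.residual-independent {G′ = G′} (exchange-iso δ₁ δ₂ ind)
  where
  module ρ₁ = GraphResidual δ₁ δ₂ ind
  module ρ₂ = GraphResidual δ₂ δ₁ (ParallelIndependent-sym δ₁ δ₂ ind)
  G′ = resultTLRG ρ₁.residual-match
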